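{- Let $\beta\in S_n$ have cycle type $(c_1,\dots,c_n)$ and let $k$ be an integer with $3\le k\le n$. Then \[ c(\lambda_{k^{(1)}},\beta)=|C_{S_n}(\beta)|\sum_{\ell= k}^{n} c_\ell\binom{\ell}{k} f(k). \]
   Context: $S_n$ is the symmetric group on $[n]$, products composed right to left. The cycle type $(c_1,\dots,c_n)$ means $\beta$ has exactly $c_i$ cycles of length $i$ (fixed points counted as $1$-cycles). $C_{S_n}(\beta)$ is the centralizer of $\beta$ in $S_n$. A point $a$ is a bad commuting point of $\alpha,\beta$ if $\alpha\beta(a)\ne\beta\alpha(a)$; $\alpha$ $k$-commutes with $\beta$ if there are exactly $k$ bad commuting points. $c(\lambda_{k^{(1)}},\beta)$ is the number of $\alpha\in S_n$ that $k$-commute with $\beta$ and such that all $k$ bad commuting points lie in a single cycle of $\beta$. $f(k)$ is the number of $k$-cycles $\tau$ of $\{1,\dots,k\}$ with $\tau(a)\ne a+1 \bmod k$ for all $a\in[k]$ (with the convention $k \bmod k=k$). -}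

module Defs where

open import Data.Nat using (ℕ; zero; suc; _+_; _*_; _∸_; _<_; _≤_; NonZero)
open import Data.Nat.Combinatorics using (_C_)
open import Data.Nat.DivMod using (_mod_)
open import Data.Fin using (Fin; toℕ) renaming (zero to fzero; suc to fsuc; _≤_ to _≤ᶠ_)
open import Data.Fin.Properties using (any?; all?) renaming (_≟_ to _≟ᶠ_; _≤?_ to _≤ᶠ?_)
import Data.Nat.Properties as ℕP
open import Data.List using (List; []; _∷_; map; concatMap; filter; length; applyUpTo; allFin)
open import Data.Nat.ListAction using (sum)
open import Data.Product using (Σ; ∃; _×_; _,_)
open import Relation.Binary.PropositionalEquality using (_≡_)
open import Relation.Nullary using (Dec; ¬_; yes; no)
open import Relation.Nullary.Decidable using (_→-dec_; _×-dec_; ¬?)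

Fun : ℕ → Set
Fun n = Fin n → Fin n

_∘ₚ_ : ∀ {n} → Fun n → Fun n → Fun n
(α ∘ₚ β) a = α (β a)

IsPerm : ∀ {n} → Fun n → Set
IsPerm {n} f = (i j : Fin n) → f i ≡ f j → i ≡ j

isPerm? : ∀ {n} (f : Fun n) → Dec (IsPerm f)
isPerm? f = all? λ i → all? λ j → (f i ≟ᶠ f j) →-dec (i ≟ᶠ j)

consF : ∀ {n m} → Fin m → (Fin n → Fin m) → (Fin (suc n) → Fin m)
consF x g fzero = x
consF x g (fsuc i) = g i

allFunsTo : (n m : ℕ) → List (Fin n → Fin m)
allFunsTo zero m = (λ ()) ∷ []
allFunsTo (suc n) m =
  concatMap (λ x → map (consF x) (allFunsTo n m)) (allFin m)

Sym : (n : ℕ) → List (Fun n)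
Sym n = filter isPerm? (allFunsTo n n)

countSym : (n : ℕ) {P : Fun n → Set} → ((α : Fun n) → Dec (P α)) → ℕ
countSym n P? = length (filter P? (Sym n))

countFin : (n : ℕ) {P : Fin n → Set} → ((a : Fin n) → Dec (P a)) → ℕ
countFin n P? = length (filter P? (allFin n))

iter : ∀ {n} → Fun n → ℕ → Fin n → Fin n
iter β zero a = a
iter β (suc m) a = β (iter β m a)

-- b lies in the cycle of β through a  (b = β^m a for some m < n; every
-- element of the orbit of a is reached within n steps).
SameCycle : ∀ {n} → Fun n → Fin n → Fin n → Set
SameCycle {n} β a b = Σ (Fin n) λ m → iter β (toℕ m) a ≡ b

sameCycle? : ∀ {n} (β : Fun n) (a b : Fin n) → Dec (SameCycle β a b)
sameCycle? β a b = any? λ m → iter β (toℕ m) a ≟ᶠ b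

cycleLen : ∀ {n} → Fun n → Fin n → ℕ
cycleLen {n} β a = countFin n (sameCycle? β a)

-- a is the least point of its β-cycle (each cycle has exactly one such point).
IsCycleRep : ∀ {n} → Fun n → Fin n → Set
IsCycleRep {n} β a = (b : Fin n) → SameCycle β a b → a ≤ᶠ b

isCycleRep? : ∀ {n} (β : Fun n) (a : Fin n) → Dec (IsCycleRep β a)
isCycleRep? β a = all? λ b → sameCycle? β a b →-dec (a ≤ᶠ? b)

cycleCount : ∀ {n} → Fun n → ℕ → ℕ
cycleCount {n} β ℓ = countFin n (λ a → isCycleRep? β a ×-dec (cycleLen β a ℕP.≟ ℓ))

Commute : ∀ {n} → Fun n → Fun n → Set
Commute {n} α β = (a : Fin n) → α (β a) ≡ β (α a)

centralizerSize : ∀ {n} → Fun n → ℕ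
centralizerSize {n} β = countSym n (λ α → all? λ a → α (β a) ≟ᶠ β (α a))

Bad : ∀ {n} → Fun n → Fun n → Fin n → Set
Bad α β a = ¬ (α (β a) ≡ β (α a))

bad? : ∀ {n} (α β : Fun n) (a : Fin n) → Dec (Bad α β a)
bad? α β a = ¬? (α (β a) ≟ᶠ β (α a))

numBad : ∀ {n} → Fun n → Fun n → ℕ
numBad {n} α β = countFin n (bad? α β)

KCommOneCycle : ∀ {n} → ℕ → Fun n → Fun n → Set
KCommOneCycle {n} k β α =
  (numBad α β ≡ k) × Σ (Fin n) λ c → (a : Fin n) → Bad α β a → SameCycle β c a

kCommOneCycle? : ∀ {n} (k : ℕ) (β α : Fun n) → Dec (KCommOneCycle k β α)
kCommOneCycle? k β α =
  (numBad α β ℕP.≟ k) ×-dec (any? λ c → all? λ a → bad? α β a →-dec sameCycle? β c a)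

cLam : ∀ {n} → ℕ → Fun n → ℕ
cLam {n} k β = countSym n (kCommOneCycle? k β)

succMod : ∀ {k} .{{_ : NonZero k}} → Fin k → Fin k
succMod {k} a = suc (toℕ a) mod k

IsFullCycle : ∀ {k} → Fun k → Set
IsFullCycle {k} τ = (a : Fin k) → cycleLen τ a ≡ k

-- f(k): number of k-cycles τ of [k] with τ(a) ≠ a+1 mod k for all a.
-- (Only used for k ≥ 3; for k = 0 we set f 0 = 0.)
f : ℕ → ℕ
f zero = 0
f (suc m) = countSym (suc m) λ τ →
  (all? λ a → cycleLen τ a ℕP.≟ suc m) ×-dec (all? λ a → ¬? (τ a ≟ᶠ succMod a))

sumFromTo : ℕ → ℕ → (ℕ → ℕ) → ℕ
sumFromTo k n g = sum (applyUpTo (λ i → g (k + i)) (suc n ∸ k))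

{-# OPTIONS --safe #-}
-- Fix a cycle of β, of length ℓ, with points e 0, e 1, … in cyclic order. If all bad points of α lie
-- on it, then α⁻¹βα permutes the cycle, again as an ℓ-cycle (compare the numbers of points on
-- ℓ-cycles), and read through e it is an ℓ-cycle τ on Fin ℓ that differs from x ↦ x + 1 exactly at
-- the k bad points. Each such τ arises from a coset of the centralizer of β. Counting pairs of such
-- a τ and a point i with τ i = i + 1, and contracting i (after a rotation, i = 0), gives
-- (ℓ + 1 - k) N(ℓ + 1, k) = (ℓ + 1) N(ℓ, k) for the number N(ℓ, k) of these τ; as N(k, k) = f k,
-- this means N(ℓ, k) = C(ℓ, k) f k.
module Submission where

open import Defs
open import Data.Bool using (true; false; if_then_else_)
open import Data.Fin using (Fin; toℕ; fromℕ; fromℕ<; inject₁; zero; suc)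
import Data.Fin.Induction as Fin
import Data.Fin.Properties as Fin
open import Data.Fin.Relation.Unary.Top using (view; ‵fromℕ; ‵inject₁)
open import Data.List using (List; []; _∷_; _++_; map; concatMap; filter; length; upTo; allFin)
open import Data.List.Membership.Propositional using (_∈_; lose)
open import Data.List.Membership.Propositional.Properties using (∈-allFin; ∈-upTo⁺; ∈-filter⁺)
import Data.List.Properties as List
open import Data.List.Relation.Unary.All as All using ([]; _∷_)
open import Data.List.Relation.Unary.AllPairs using ([]; _∷_)
open import Data.List.Relation.Unary.Any using (here; there)
open import Data.List.Relation.Unary.Unique.Propositional using (Unique)
open import Data.List.Relation.Unary.Unique.Propositional.Properties using (upTo⁺; allFin⁺)
open import Data.Nat using (ℕ; zero; suc; _+_; _*_; _∸_; _≤_; _<_; s≤s; s≤s⁻¹; NonZero; _!)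
open import Data.Nat.Combinatorics using (_C_; nCn≡1; k>n⇒nCk≡0; nCk≡n!/k![n-k]!; k![n∸k]!∣n!)
open import Data.Nat.DivMod using (_/_; _%_; m≡m%n+[m/n]*n; m%n<n; m<n⇒m%n≡m; n%n≡0; m/n*n≡m)
open import Data.Nat.ListAction using (sum)
open import Data.Nat.Properties using (+-comm; +-suc; +-identityʳ; *-comm; *-assoc; *-identityˡ; *-identityʳ; *-zeroʳ; *-distribˡ-+; ≤-trans; ≤-reflexive; suc-injective; _!*_!≢0)
import Data.Nat.Properties as ℕ
open import Algebra.Properties.CommutativeSemigroup ℕ.+-commutativeSemigroup using (interchange)
open import Algebra.Properties.CommutativeSemigroup ℕ.*-commutativeSemigroup using (x∙yz≈y∙xz; xy∙z≈xz∙y)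
open import Data.Product using (∃; _×_; _,_; proj₁; proj₂)
open import Data.Unit using (tt)
open import Function using (_∘_; id)
open import Relation.Binary using (tri<; tri≈; tri>)
open import Relation.Binary.PropositionalEquality using (_≡_; _≢_; refl; sym; trans; cong; subst; _≗_; module ≡-Reasoning)
open import Relation.Nullary using (Dec; ¬_; yes; no; does; contradiction)
open import Relation.Nullary.Decidable using (_×-dec_; _→-dec_; ¬?; decidable-stable)
open import Relation.Unary using (Decidable)

-- A point a is bad exactly when β and α⁻¹βα differ at a, so the bad points depend on α only through
-- this conjugate, and two permutations give the same conjugate exactly when they differ by a left
-- factor in the centralizer. Conversely, any ℓ-cycle τ on the chosen cycle, completed by β
-- elsewhere, has the cycle type of β and is therefore such a conjugate. As k is positive there is a
-- bad point; it determines the cycle, so the counts for separate cycles add up. The obstacle is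
-- that functions are compared pointwise only: the lists contain each function up to `≗`, so
-- correspondences are not given as maps with inverses. Each is a decidable relation whose rows and
-- columns are counted, and properties are transferred along the relation. This favours the
-- recurrence in ℓ: contracting one point at a time is a simple relation, while a direct proof of
-- C(ℓ, k) f k would contract an arbitrary set of ℓ - k points and relabel the rest.

private variable
  A B : Set
  l m n : ℕ

-- Counting over lists

count : {P : A → Set} → Decidable P → List A → ℕ
count P? xs = length (filter P? xs)

∑ : List A → (A → ℕ) → ℕ
∑ xs g = sum (map g xs)

𝟙 : {P : Set} → Dec P → ℕ
𝟙 d = if does d then 1 else 0

∑-cong : (xs : List A) {g h : A → ℕ} → g ≗ h → ∑ xs g ≡ ∑ xs h
∑-cong xs g≗h = cong sum (List.map-cong g≗h xs)

∑-zero : (xs : List A) → ∑ xs (λ _ → 0) ≡ 0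
∑-zero [] = refl
∑-zero (x ∷ xs) = ∑-zero xs

∑-+ : (xs : List A) (g h : A → ℕ) → ∑ xs (λ x → g x + h x) ≡ ∑ xs g + ∑ xs h
∑-+ [] g h = refl
∑-+ (x ∷ xs) g h = trans (cong (g x + h x +_) (∑-+ xs g h)) (interchange (g x) (h x) _ _)

∑-*ˡ : ∀ c (xs : List A) (g : A → ℕ) → ∑ xs (λ x → c * g x) ≡ c * ∑ xs g
∑-*ˡ c [] g = sym (*-zeroʳ c)
∑-*ˡ c (x ∷ xs) g = trans (cong (c * g x +_) (∑-*ˡ c xs g)) (sym (*-distribˡ-+ c (g x) _))

∑-*ʳ : ∀ c (xs : List A) (g : A → ℕ) → ∑ xs (λ x → g x * c) ≡ ∑ xs g * c
∑-*ʳ c xs g = trans (∑-cong xs (λ x → *-comm (g x) c)) (trans (∑-*ˡ c xs g) (*-comm c _))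

∑-swap : (xs : List A) (ys : List B) (g : A → B → ℕ) →
         ∑ xs (λ x → ∑ ys (g x)) ≡ ∑ ys (λ y → ∑ xs (λ x → g x y))
∑-swap [] ys g = sym (∑-zero ys)
∑-swap (x ∷ xs) ys g =
  trans (cong (∑ ys (g x) +_) (∑-swap xs ys g)) (sym (∑-+ ys (g x) _))

count≡∑ : {P : A → Set} (P? : Decidable P) (xs : List A) → count P? xs ≡ ∑ xs (λ x → 𝟙 (P? x))
count≡∑ P? [] = refl
count≡∑ P? (x ∷ xs) with does (P? x)
... | true = cong suc (count≡∑ P? xs)
... | false = count≡∑ P? xs

count-++ : {P : A → Set} (P? : Decidable P) (xs ys : List A) →
           count P? (xs ++ ys) ≡ count P? xs + count P? ys
count-++ P? xs ys = trans (cong length (List.filter-++ P? xs ys)) (List.length-++ (filter P? xs))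

count-map : {P : B → Set} (P? : Decidable P) (g : A → B) (xs : List A) →
            count P? (map g xs) ≡ count (λ x → P? (g x)) xs
count-map P? g [] = refl
count-map P? g (x ∷ xs) with does (P? (g x))
... | true = cong suc (count-map P? g xs)
... | false = count-map P? g xs

count-concatMap : {P : B → Set} (P? : Decidable P) (g : A → List B) (xs : List A) →
                  count P? (concatMap g xs) ≡ ∑ xs (λ x → count P? (g x))
count-concatMap P? g [] = refl
count-concatMap P? g (x ∷ xs) =
  trans (count-++ P? (g x) _) (cong (count P? (g x) +_) (count-concatMap P? g xs))

count-filter : {P Q : A → Set} (P? : Decidable P) (Q? : Decidable Q) (xs : List A) →
               count P? (filter Q? xs) ≡ count (λ x → Q? x ×-dec P? x) xs
count-filter P? Q? [] = refl
count-filter P? Q? (x ∷ xs) with does (Q? x)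
... | false = count-filter P? Q? xs
... | true with does (P? x)
...   | true = cong suc (count-filter P? Q? xs)
...   | false = count-filter P? Q? xs

count-⇔ : {P Q : A → Set} (P? : Decidable P) (Q? : Decidable Q) →
          (∀ x → P x → Q x) → (∀ x → Q x → P x) → (xs : List A) → count P? xs ≡ count Q? xs
count-⇔ P? Q? p⇒q q⇒p xs = cong length (List.filter-≐ P? Q? ((λ {x} → p⇒q x) , (λ {x} → q⇒p x)) xs)

count-none : {P : A → Set} (P? : Decidable P) → (∀ x → ¬ P x) → (xs : List A) → count P? xs ≡ 0
count-none P? ¬p xs = cong length (List.filter-none P? (All.universal ¬p xs))

count-all : {P : A → Set} (P? : Decidable P) → (∀ x → P x) → (xs : List A) → count P? xs ≡ length xs
count-all P? p xs = cong length (List.filter-all P? (All.universal p xs))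

count-× : {P : Set} {Q : A → Set} (P? : Dec P) (Q? : Decidable Q) (xs : List A) →
          count (λ x → P? ×-dec Q? x) xs ≡ 𝟙 P? * count Q? xs
count-× (yes p) Q? xs = trans (count-⇔ _ Q? (λ _ → proj₂) (λ _ → p ,_) xs) (sym (*-identityˡ _))
count-× (no ¬p) Q? xs = count-none _ (λ _ → ¬p ∘ proj₁) xs

count-¬ : {P : A → Set} (P? : Decidable P) (xs : List A) →
          count P? xs + count (λ x → ¬? (P? x)) xs ≡ length xs
count-¬ P? [] = refl
count-¬ P? (x ∷ xs) with does (P? x)
... | true = cong suc (count-¬ P? xs)
... | false = trans (+-suc _ _) (cong suc (count-¬ P? xs))

count-swap : {R : A → B → Set} (R? : ∀ x y → Dec (R x y)) (xs : List A) (ys : List B) →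
             ∑ xs (λ x → count (R? x) ys) ≡ ∑ ys (λ y → count (λ x → R? x y) xs)
count-swap R? xs ys = begin
  ∑ xs (λ x → count (R? x) ys)            ≡⟨ ∑-cong xs (λ x → count≡∑ (R? x) ys) ⟩
  ∑ xs (λ x → ∑ ys (λ y → 𝟙 (R? x y)))    ≡⟨ ∑-swap xs ys _ ⟩
  ∑ ys (λ y → ∑ xs (λ x → 𝟙 (R? x y)))    ≡⟨ ∑-cong ys (λ y → count≡∑ (λ x → R? x y) xs) ⟨
  ∑ ys (λ y → count (λ x → R? x y) xs)    ∎
  where open ≡-Reasoning

count-partition : {P : A → Set} {R : A → B → Set} (P? : Decidable P) (R? : ∀ x y → Dec (R x y))
                  (xs : List A) (ys : List B) →
                  (∀ x → P x → count (R? x) ys ≡ 1) → (∀ x y → R x y → P x) →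
                  count P? xs ≡ ∑ ys (λ y → count (λ x → R? x y) xs)
count-partition P? R? xs ys unique r⇒p =
  trans (count≡∑ P? xs) (trans (∑-cong xs fibre) (count-swap R? xs ys))
  where
  fibre : ∀ x → 𝟙 (P? x) ≡ count (R? x) ys
  fibre x with P? x
  ... | yes p = sym (unique x p)
  ... | no ¬p = sym (count-none (R? x) (λ y r → ¬p (r⇒p x y r)) ys)

-- Both sides count the related pairs, by rows and by columns. With u = v = 1 this replaces a
-- bijection; other values give the cosets of the centralizer and the recurrence for full cycles.
double-count : {P : A → Set} {Q : B → Set} {R : A → B → Set}
               (P? : Decidable P) (Q? : Decidable Q) (R? : ∀ x y → Dec (R x y))
               (xs : List A) (ys : List B) (u v : ℕ) →
               (∀ x → P x → count (λ y → Q? y ×-dec R? x y) ys ≡ u) →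
               (∀ y → Q y → count (λ x → P? x ×-dec R? x y) xs ≡ v) →
               count P? xs * u ≡ count Q? ys * v
double-count P? Q? R? xs ys u v rows columns = begin
  count P? xs * u
    ≡⟨ cong (_* u) (count≡∑ P? xs) ⟩
  ∑ xs (λ x → 𝟙 (P? x)) * u
    ≡⟨ ∑-*ʳ u xs _ ⟨
  ∑ xs (λ x → 𝟙 (P? x) * u)
    ≡⟨ ∑-cong xs row ⟩
  ∑ xs (λ x → count (λ y → P? x ×-dec (Q? y ×-dec R? x y)) ys)
    ≡⟨ count-swap (λ x y → P? x ×-dec (Q? y ×-dec R? x y)) xs ys ⟩
  ∑ ys (λ y → count (λ x → P? x ×-dec (Q? y ×-dec R? x y)) xs)
    ≡⟨ ∑-cong ys column ⟩
  ∑ ys (λ y → 𝟙 (Q? y) * v)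
    ≡⟨ ∑-*ʳ v ys _ ⟩
  ∑ ys (λ y → 𝟙 (Q? y)) * v
    ≡⟨ cong (_* v) (count≡∑ Q? ys) ⟨
  count Q? ys * v ∎
  where
  open ≡-Reasoning
  row : ∀ x → 𝟙 (P? x) * u ≡ count (λ y → P? x ×-dec (Q? y ×-dec R? x y)) ys
  row x = trans (weigh (P? x)) (sym (count-× (P? x) _ ys))
    where
    weigh : (d : Dec _) → 𝟙 d * u ≡ 𝟙 d * count (λ y → Q? y ×-dec R? x y) ys
    weigh (yes p) = cong (1 *_) (sym (rows x p))
    weigh (no _) = refl
  column : ∀ y → count (λ x → P? x ×-dec (Q? y ×-dec R? x y)) xs ≡ 𝟙 (Q? y) * v
  column y = trans (count-⇔ _ (λ x → Q? y ×-dec (P? x ×-dec R? x y))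
                     (λ _ (p , q , r) → q , p , r) (λ _ (q , p , r) → p , q , r) xs)
                   (trans (count-× (Q? y) _ xs) (weigh (Q? y)))
    where
    weigh : (d : Dec _) → 𝟙 d * count (λ x → P? x ×-dec R? x y) xs ≡ 𝟙 d * v
    weigh (yes q) = cong (1 *_) (columns y q)
    weigh (no _) = refl

count-∈ : {P : A → Set} (P? : Decidable P) {xs : List A} → Unique xs → ∀ {a} → a ∈ xs →
          P a → (∀ b → P b → b ≡ a) → count P? xs ≡ 1
count-∈ {P = P} P? (a∉xs ∷ _) (here refl) p only =
  trans (cong length (List.filter-accept P? p))
        (cong (suc ∘ length) (List.filter-none P? (All.map (λ a≢b q → a≢b (sym (only _ q))) a∉xs)))
count-∈ {P = P} P? {x ∷ xs} (x∉xs ∷ unique) (there a∈xs) p only =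
  trans (cong length (List.filter-reject P? (λ q → All.lookup x∉xs a∈xs (only x q))))
        (count-∈ P? unique a∈xs p only)

count-Fin : {P : Fin n → Set} (P? : Decidable P) (a : Fin n) →
            P a → (∀ b → P b → b ≡ a) → count P? (allFin n) ≡ 1
count-Fin {n = n} P? a = count-∈ P? (allFin⁺ n) (∈-allFin a)

length-allFin : ∀ n → length (allFin n) ≡ n
length-allFin n = List.length-tabulate id

-- Without function extensionality a function occurs in allFunsTo only up to ≗.
count-Fun : {P : (Fin n → Fin m) → Set} (P? : Decidable P) (g : Fin n → Fin m) →
            (∀ h → h ≗ g → P h) → (∀ h → P h → h ≗ g) → count P? (allFunsTo n m) ≡ 1
count-Fun {zero} P? g all only = cong length (List.filter-accept P? {xs = []} (all _ λ ()))
count-Fun {suc n} {m} {P} P? g all only = begin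
  count P? (allFunsTo (suc n) m)
    ≡⟨ count-concatMap P? (λ x → map (consF x) (allFunsTo n m)) (allFin m) ⟩
  ∑ (allFin m) (λ x → count P? (map (consF x) (allFunsTo n m)))
    ≡⟨ ∑-cong (allFin m) (λ x → count-map P? (consF x) (allFunsTo n m)) ⟩
  ∑ (allFin m) (λ x → count (λ h → P? (consF x h)) (allFunsTo n m))
    ≡⟨ ∑-cong (allFin m) fibre ⟩
  ∑ (allFin m) (λ x → 𝟙 (x Fin.≟ g zero))
    ≡⟨ count≡∑ (Fin._≟ g zero) (allFin m) ⟨
  count (Fin._≟ g zero) (allFin m)
    ≡⟨ count-Fin (Fin._≟ g zero) (g zero) refl (λ _ → id) ⟩
  1 ∎
  where
  open ≡-Reasoning
  fibre : ∀ x → count (λ h → P? (consF x h)) (allFunsTo n m) ≡ 𝟙 (x Fin.≟ g zero)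
  fibre x with x Fin.≟ g zero
  ... | no x≢ = count-none _ (λ h p → x≢ (only _ p zero)) (allFunsTo n m)
  ... | yes refl = count-Fun (λ h → P? (consF x h)) (g ∘ suc)
          (λ h h≗ → all _ λ { zero → refl ; (suc i) → h≗ i })
          (λ h p i → only _ p (suc i))

count-Fin-image : {P : Fin n → Set} {Q : Fin m → Set} (P? : Decidable P) (Q? : Decidable Q)
                  (e : Fin m → Fin n) → (∀ i j → e i ≡ e j → i ≡ j) →
                  (∀ j → Q j → P (e j)) → (∀ j → P (e j) → Q j) → (∀ a → P a → ∃ λ j → e j ≡ a) →
                  count P? (allFin n) ≡ count Q? (allFin m)
count-Fin-image {n} {m} {P} P? Q? e e-inj q⇒p p⇒q onto = begin
  count P? (allFin n)       ≡⟨ *-identityʳ _ ⟨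
  count P? (allFin n) * 1   ≡⟨ double-count P? Q? (λ a j → e j Fin.≟ a) (allFin n) (allFin m) 1 1
                                 rows (λ j q → count-Fin _ (e j) (q⇒p j q , refl) (λ _ → sym ∘ proj₂)) ⟩
  count Q? (allFin m) * 1   ≡⟨ *-identityʳ _ ⟩
  count Q? (allFin m)       ∎
  where
  open ≡-Reasoning
  rows : ∀ a → P a → count (λ j → Q? j ×-dec (e j Fin.≟ a)) (allFin m) ≡ 1
  rows a p with onto a p
  ... | j , refl = count-Fin _ j (p⇒q j p , refl) (λ i → e-inj i j ∘ proj₂)

-- The points of Q outside P number count Q minus count P, which is 0. This turns equal counts back
-- into statements about single points, as when a full cycle is shown to be transitive.
count-⊆ : {P Q : Fin n → Set} (P? : Decidable P) (Q? : Decidable Q) → (∀ a → P a → Q a) →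
          count P? (allFin n) ≡ count Q? (allFin n) → ∀ a → Q a → P a
count-⊆ {n} P? Q? p⇒q eq a q = decidable-stable (P? a) λ ¬p →
  ℕ.<-irrefl (sym rest≡0) (List.filter-some (¬? ∘ P?) (lose (∈-filter⁺ Q? (∈-allFin a) q) ¬p))
  where
  Qs = filter Q? (allFin n)
  both : count P? Qs ≡ count Q? (allFin n)
  both = trans (trans (count-filter P? Q? (allFin n))
                 (count-⇔ _ P? (λ _ → proj₂) (λ b p → p⇒q b p , p) (allFin n))) eq
  rest≡0 : count (¬? ∘ P?) Qs ≡ 0
  rest≡0 = ℕ.+-cancelˡ-≡ (count P? Qs) _ 0
    (trans (count-¬ P? Qs) (trans (sym both) (sym (+-identityʳ _))))

-- Cycles of a permutation

iter-+ : (β : Fun n) → ∀ l m a → iter β (l + m) a ≡ iter β l (iter β m a)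
iter-+ β zero m a = refl
iter-+ β (suc l) m a = cong β (iter-+ β l m a)

iter-injective : {β : Fun n} → IsPerm β → ∀ m → IsPerm (iter β m)
iter-injective β-perm zero i j eq = eq
iter-injective β-perm (suc m) i j eq = iter-injective β-perm m i j (β-perm _ _ eq)

iter-cancel : {β : Fun n} → IsPerm β → ∀ {i j a} → i < j → iter β i a ≡ iter β j a →
              iter β (j ∸ i) a ≡ a
iter-cancel {β = β} β-perm {i} {j} {a} i<j eq = iter-injective β-perm i _ _ (begin
  iter β i (iter β (j ∸ i) a)   ≡⟨ iter-+ β i (j ∸ i) a ⟨
  iter β (i + (j ∸ i)) a        ≡⟨ cong (λ x → iter β x a) (ℕ.m+[n∸m]≡n (ℕ.<⇒≤ i<j)) ⟩
  iter β j a                    ≡⟨ eq ⟨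
  iter β i a                    ∎)
  where open ≡-Reasoning

iter-multiple : (β : Fun n) → ∀ p {a} → iter β p a ≡ a → ∀ m → iter β (m * p) a ≡ a
iter-multiple β p period zero = refl
iter-multiple β p period (suc m) =
  trans (iter-+ β p (m * p) _) (trans (cong (iter β p) (iter-multiple β p period m)) period)

iter-% : (β : Fun n) → ∀ p .{{_ : NonZero p}} {a} → iter β p a ≡ a → ∀ m → iter β m a ≡ iter β (m % p) a
iter-% β p {a} period m = begin
  iter β m a                              ≡⟨ cong (λ x → iter β x a) (m≡m%n+[m/n]*n m p) ⟩
  iter β (m % p + m / p * p) a            ≡⟨ iter-+ β (m % p) (m / p * p) a ⟩
  iter β (m % p) (iter β (m / p * p) a)   ≡⟨ cong (iter β (m % p)) (iter-multiple β p period (m / p)) ⟩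
  iter β (m % p) a                        ∎
  where open ≡-Reasoning

-- Two of the n + 1 points β^0 a, ..., β^n a coincide, and the smaller exponent can be cancelled.
-- The negative form is what the search for the smallest return in `least-period` takes as input.
orbit-returns : {β : Fun n} → IsPerm β → ∀ a → ¬ (∀ (i : Fin n) → iter β (suc (toℕ i)) a ≢ a)
orbit-returns {n} {β} β-perm a never
  with i , j , i<j , eq ← Fin.pigeonhole (ℕ.n<1+n n) (λ (i : Fin (suc n)) → iter β (toℕ i) a)
  with toℕ j ∸ toℕ i in d≡ | ℕ.m<n⇒0<n∸m i<j | iter-cancel β-perm i<j eq
... | suc d | _ | returns = never (fromℕ< d<n) (trans (cong (λ x → iter β (suc x) a) (Fin.toℕ-fromℕ< d<n)) returns)
  where
  d<n : d < n
  d<n = ≤-trans (≤-reflexive (sym d≡)) (≤-trans (ℕ.m∸n≤m (toℕ j) (toℕ i)) (s≤s⁻¹ (Fin.toℕ<n j)))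

least-period : {β : Fun n} → IsPerm β → ∀ a →
               ∃ λ q → suc q ≤ n × iter β (suc q) a ≡ a × (∀ r → r < q → iter β (suc r) a ≢ a)
least-period {n} {β} β-perm a
  with i , ¬¬returns , before ← Fin.¬∀⟶∃¬-smallest n (λ i → iter β (suc (toℕ i)) a ≢ a)
         (λ i → ¬? (iter β (suc (toℕ i)) a Fin.≟ a)) (orbit-returns β-perm a)
  = toℕ i , Fin.toℕ<n i , decidable-stable (_ Fin.≟ a) ¬¬returns , λ r r<i →
    subst (λ x → iter β (suc x) a ≢ a) (trans (Fin.toℕ-inject _) (Fin.toℕ-fromℕ< r<i)) (before (fromℕ< r<i))

abstract
  -- If b returns after q + 1 steps, β^q b is a preimage of b. Being abstract, it keeps inverses
  -- from unfolding into the search for a period.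
  perm-surjective : {β : Fun n} → IsPerm β → ∀ b → ∃ λ a → β a ≡ b
  perm-surjective {β = β} β-perm b with q , _ , returns , _ ← least-period β-perm b = iter β q b , returns

-- `SameCycle` admits only exponents below n; reduction modulo the least period of a, which is at
-- most n, brings every exponent into this range.
iter⇒sameCycle : {β : Fun n} → IsPerm β → ∀ m {a b} → iter β m a ≡ b → SameCycle β a b
iter⇒sameCycle {β = β} β-perm m {a} refl
  with q , q<n , returns , _ ← least-period β-perm a
  = fromℕ< bound , trans (cong (λ x → iter β x a) (Fin.toℕ-fromℕ< bound)) (sym (iter-% β (suc q) returns m))
  where bound = ≤-trans (m%n<n m (suc q)) q<n

sameCycle-refl : {β : Fun n} → IsPerm β → ∀ a → SameCycle β a a
sameCycle-refl β-perm a = iter⇒sameCycle β-perm 0 refl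

sameCycle-step : {β : Fun n} → IsPerm β → ∀ {a b} → SameCycle β a b → SameCycle β a (β b)
sameCycle-step {β = β} β-perm (m , eq) = iter⇒sameCycle β-perm (suc (toℕ m)) (cong β eq)

sameCycle-trans : {β : Fun n} → IsPerm β → ∀ {a b c} → SameCycle β a b → SameCycle β b c → SameCycle β a c
sameCycle-trans {β = β} β-perm {a} (l , refl) (m , refl) =
  iter⇒sameCycle β-perm (toℕ m + toℕ l) (iter-+ β (toℕ m) (toℕ l) a)

sameCycle-sym : {β : Fun n} → IsPerm β → ∀ {a b} → SameCycle β a b → SameCycle β b a
sameCycle-sym {β = β} β-perm {a} (m , refl) with q , _ , returns , _ ← least-period β-perm a =
  -- With q + 1 the period of a, β^(m q) undoes β^m at a, because m q + m is a multiple of the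
  -- period.
  iter⇒sameCycle β-perm (toℕ m * q) (begin
    iter β (toℕ m * q) (iter β (toℕ m) a)   ≡⟨ iter-+ β (toℕ m * q) (toℕ m) a ⟨
    iter β (toℕ m * q + toℕ m) a            ≡⟨ cong (λ x → iter β x a) (+-comm (toℕ m * q) (toℕ m)) ⟩
    iter β (toℕ m + toℕ m * q) a            ≡⟨ cong (λ x → iter β x a) (ℕ.*-suc (toℕ m) q) ⟨
    iter β (toℕ m * suc q) a                ≡⟨ iter-multiple β (suc q) returns (toℕ m) ⟩
    a                                       ∎)
  where open ≡-Reasoning

cycleLen≤n : (β : Fun n) → ∀ a → cycleLen β a ≤ n
cycleLen≤n {n} β a =
  ≤-trans (List.length-filter (sameCycle? β a) (allFin n)) (≤-reflexive (length-allFin n))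

cycleLen-sameCycle : {β : Fun n} → IsPerm β → ∀ {a b} → SameCycle β a b → cycleLen β a ≡ cycleLen β b
cycleLen-sameCycle {n} {β} β-perm {a} {b} a~b = count-⇔ (sameCycle? β a) (sameCycle? β b)
  (λ _ → sameCycle-trans β-perm (sameCycle-sym β-perm a~b))
  (λ _ → sameCycle-trans β-perm a~b) (allFin n)

cycleRep : {β : Fun n} → IsPerm β → ∀ a → ∃ λ c → IsCycleRep β c × SameCycle β c a
cycleRep {n} {β} β-perm a
  with c , ¬¬a~c , before ← Fin.¬∀⟶∃¬-smallest n (λ b → ¬ SameCycle β a b) (λ b → ¬? (sameCycle? β a b))
                              (λ none → none a (sameCycle-refl β-perm a))
  = c , least , sameCycle-sym β-perm a~c
  where
  a~c = decidable-stable (sameCycle? β a c) ¬¬a~c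
  least : IsCycleRep β c
  least b c~b = ℕ.≮⇒≥ λ b<c → before (fromℕ< b<c)
    (subst (SameCycle β a) (Fin.toℕ-injective (sym (trans (Fin.toℕ-inject _) (Fin.toℕ-fromℕ< b<c))))
           (sameCycle-trans β-perm a~c c~b))

cycleRep-unique : {β : Fun n} → IsPerm β → ∀ {a c d} → IsCycleRep β c → SameCycle β c a →
                  IsCycleRep β d → SameCycle β d a → c ≡ d
cycleRep-unique β-perm {a} {c} {d} c-rep c~a d-rep d~a = Fin.≤-antisym
  (c-rep d (sameCycle-trans β-perm c~a (sameCycle-sym β-perm d~a)))
  (d-rep c (sameCycle-trans β-perm d~a (sameCycle-sym β-perm c~a)))

-- The successor map, intertwining maps and charts of cycles

succMod-fromℕ : ∀ m → succMod (fromℕ m) ≡ zero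
succMod-fromℕ m = Fin.toℕ-injective (trans (Fin.toℕ-fromℕ< _)
  (trans (cong (λ x → suc x % suc m) (Fin.toℕ-fromℕ m)) (n%n≡0 (suc m))))

succMod-inject₁ : (i : Fin m) → succMod (inject₁ i) ≡ suc i
succMod-inject₁ {m} i = Fin.toℕ-injective (trans (Fin.toℕ-fromℕ< _)
  (trans (cong (λ x → suc x % suc m) (Fin.toℕ-inject₁ i)) (m<n⇒m%n≡m (s≤s (Fin.toℕ<n i)))))

succMod-perm : ∀ m → IsPerm (succMod {suc m})
succMod-perm m i j eq with view i | view j
... | ‵fromℕ | ‵fromℕ = refl
... | ‵fromℕ | ‵inject₁ j with () ← trans (trans (sym (succMod-fromℕ m)) eq) (succMod-inject₁ j)
... | ‵inject₁ i | ‵fromℕ with () ← trans (trans (sym (succMod-inject₁ i)) eq) (succMod-fromℕ m)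
... | ‵inject₁ i | ‵inject₁ j =
  cong inject₁ (Fin.suc-injective (trans (trans (sym (succMod-inject₁ i)) eq) (succMod-inject₁ j)))

Intertwines : (Fin m → Fin n) → Fun m → Fun n → Set
Intertwines e τ β = ∀ x → e (τ x) ≡ β (e x)

intertwines? : (e : Fin m → Fin n) (τ : Fun m) (β : Fun n) → Dec (Intertwines e τ β)
intertwines? e τ β = Fin.all? λ x → e (τ x) Fin.≟ β (e x)

iter-intertwines : (e : Fin m → Fin n) (τ : Fun m) (β : Fun n) → Intertwines e τ β →
                   ∀ l → Intertwines e (iter τ l) (iter β l)
iter-intertwines e τ β eτ≗βe zero x = refl
iter-intertwines e τ β eτ≗βe (suc l) x = trans (eτ≗βe _) (cong β (iter-intertwines e τ β eτ≗βe l x))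

-- The compatibility is required along the orbit of x only, because a permutation α with bad points
-- commutes with β on some orbits and not on others.
cycleLen-image : {τ : Fun m} {β : Fun n} → IsPerm τ → IsPerm β →
                 (e : Fin m → Fin n) → (∀ i j → e i ≡ e j → i ≡ j) →
                 ∀ x → (∀ l → e (iter τ l x) ≡ iter β l (e x)) → cycleLen β (e x) ≡ cycleLen τ x
cycleLen-image {τ = τ} {β} τ-perm β-perm e e-inj x orbit =
  count-Fin-image (sameCycle? β (e x)) (sameCycle? τ x) e e-inj
    (λ { j (l , refl) → iter⇒sameCycle β-perm (toℕ l) (sym (orbit (toℕ l))) })
    (λ j (l , eq) → iter⇒sameCycle τ-perm (toℕ l) (e-inj _ _ (trans (orbit (toℕ l)) eq)))
    (λ a (l , eq) → iter τ (toℕ l) x , trans (orbit (toℕ l)) eq)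

-- Coordinates on the cycle of c in which β becomes x ↦ x + 1. The length is written as a successor
-- so that `succMod` is defined on the coordinates.
record Chart (β : Fun n) (c : Fin n) : Set where
  field
    pred-length : ℕ
    cycleLen≡ : cycleLen β c ≡ suc pred-length
    embed : Fin (suc pred-length) → Fin n
    embed-injective : ∀ i j → embed i ≡ embed j → i ≡ j
    embed-succMod : Intertwines embed succMod β
    embed-onto : ∀ a → SameCycle β c a → ∃ λ j → embed j ≡ a
    embed-into : ∀ j → SameCycle β c (embed j)

chart : {β : Fun n} → IsPerm β → ∀ c → Chart β c
chart {n} {β} β-perm c with q , q<n , returns , least ← least-period β-perm c = record
  { pred-length = q
  ; cycleLen≡ = trans (count-Fin-image (sameCycle? β c) (λ _ → yes tt) e e-inj (λ j _ → into j) (λ _ _ → tt) onto)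
                      (trans (count-all (λ _ → yes tt) (λ _ → tt) (allFin (suc q))) (length-allFin (suc q)))
  ; embed = e
  ; embed-injective = e-inj
  ; embed-succMod = e-succMod
  ; embed-onto = onto
  ; embed-into = into
  }
  where
  e : Fin (suc q) → Fin n
  e j = iter β (toℕ j) c
  e-distinct : ∀ {i j} → toℕ i < toℕ j → e i ≢ e j
  e-distinct {i} {j} i<j eq
    -- A coincidence would give a return after j - i steps, and 0 < j - i ≤ q contradicts the
    -- minimality of the period q + 1.
    with toℕ j ∸ toℕ i in d≡ | ℕ.m<n⇒0<n∸m i<j | iter-cancel β-perm i<j eq
  ... | suc d | _ | back = least d
    (≤-trans (≤-reflexive (sym d≡)) (≤-trans (ℕ.m∸n≤m (toℕ j) (toℕ i)) (s≤s⁻¹ (Fin.toℕ<n j)))) back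
  e-inj : ∀ i j → e i ≡ e j → i ≡ j
  e-inj i j eq with Fin.<-cmp i j
  ... | tri< i<j _ _ = contradiction eq (e-distinct i<j)
  ... | tri≈ _ i≡j _ = i≡j
  ... | tri> _ _ j<i = contradiction (sym eq) (e-distinct j<i)
  e-succMod : Intertwines e succMod β
  e-succMod j with view j
  ... | ‵fromℕ = trans (cong e (succMod-fromℕ q))
          (trans (sym returns) (cong (λ x → iter β (suc x) c) (sym (Fin.toℕ-fromℕ q))))
  ... | ‵inject₁ i = trans (cong e (succMod-inject₁ i))
          (cong (λ x → iter β (suc x) c) (sym (Fin.toℕ-inject₁ i)))
  onto : ∀ a → SameCycle β c a → ∃ λ j → e j ≡ a
  onto a (l , refl) = fromℕ< (m%n<n (toℕ l) (suc q)) ,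
    trans (cong (λ x → iter β x c) (Fin.toℕ-fromℕ< (m%n<n (toℕ l) (suc q)))) (sym (iter-% β (suc q) returns (toℕ l)))
  into : ∀ j → SameCycle β c (e j)
  into j = iter⇒sameCycle β-perm (toℕ j) refl

-- Full cycles that differ from succMod in k points

agree? : (σ τ : Fun n) → ∀ a → Dec (σ a ≡ τ a)
agree? σ τ a = σ a Fin.≟ τ a

numDiff : Fun n → Fun n → ℕ
numDiff {n} σ τ = count (λ a → ¬? (agree? σ τ a)) (allFin n)

FullCycle : ℕ → Fun (suc m) → Set
FullCycle k τ = IsPerm τ × IsFullCycle τ × numDiff succMod τ ≡ k

fullCycle? : ∀ k → (τ : Fun (suc m)) → Dec (FullCycle k τ)
fullCycle? {m} k τ =
  isPerm? τ ×-dec Fin.all? (λ a → cycleLen τ a ℕ.≟ suc m) ×-dec (numDiff succMod τ ℕ.≟ k)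

-- This is N(m + 1, k) of the overview: the index is one less than the number of points.
fullCycles : ℕ → ℕ → ℕ
fullCycles m k = count (fullCycle? {m} k) (allFunsTo (suc m) (suc m))

-- The form of `IsFullCycle` that passes through insertion and contraction of a point, since paths
-- can be followed there without counting orbits.
Transitive : Fun n → Set
Transitive τ = ∀ a b → SameCycle τ a b

full⇒transitive : {τ : Fun (suc m)} → IsFullCycle τ → Transitive τ
full⇒transitive {m} {τ} full a b = count-⊆ (sameCycle? τ a) (λ _ → yes tt) (λ _ _ → tt)
  (trans (full a) (sym (trans (count-all (λ _ → yes tt) (λ _ → tt) (allFin (suc m))) (length-allFin (suc m))))) b tt

transitive⇒full : {τ : Fun (suc m)} → Transitive τ → IsFullCycle τ
transitive⇒full {m} {τ} τ-trans a =
  trans (count-all (sameCycle? τ a) (τ-trans a) (allFin (suc m))) (length-allFin (suc m))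

-- Differing from `succMod` in as many points as there are means differing everywhere, which is the
-- condition in `f`.
fullCycles-diagonal : ∀ m → fullCycles m (suc m) ≡ f (suc m)
fullCycles-diagonal m = trans
  (count-⇔ (fullCycle? (suc m)) (λ τ → isPerm? τ ×-dec P? τ)
    (λ τ (perm , full , diff) → perm , full , λ a eq →
      count-⊆ (λ a → ¬? (agree? succMod τ a)) (λ _ → yes tt) (λ _ _ → tt)
        (trans diff (sym all-points)) a tt (sym eq))
    (λ τ (perm , full , differ) → perm , full ,
      trans (count-⇔ (λ a → ¬? (agree? succMod τ a)) (λ _ → yes tt) (λ _ _ → tt) (λ a _ eq → differ a (sym eq)) (allFin (suc m))) all-points)
    (allFunsTo (suc m) (suc m)))
  (sym (count-filter P? isPerm? (allFunsTo (suc m) (suc m))))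
  where
  P? = λ (τ : Fun (suc m)) → Fin.all? (λ a → cycleLen τ a ℕ.≟ suc m) ×-dec Fin.all? (λ a → ¬? (τ a Fin.≟ succMod a))
  all-points : count (λ _ → yes tt) (allFin (suc m)) ≡ suc m
  all-points = trans (count-all (λ _ → yes tt) (λ _ → tt) (allFin (suc m))) (length-allFin (suc m))

-- Conjugation, and agreement with the successor map at a given point

inverse : {g : Fun n} → IsPerm g → Fun n
inverse g-perm a = proj₁ (perm-surjective g-perm a)

inverseʳ : {g : Fun n} (g-perm : IsPerm g) → ∀ a → g (inverse g-perm a) ≡ a
inverseʳ g-perm a = proj₂ (perm-surjective g-perm a)

inverseˡ : {g : Fun n} (g-perm : IsPerm g) → ∀ a → inverse g-perm (g a) ≡ a
inverseˡ g-perm a = g-perm _ _ (inverseʳ g-perm _)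

inverse-perm : {g : Fun n} (g-perm : IsPerm g) → IsPerm (inverse g-perm)
inverse-perm {g = g} g-perm a b eq =
  trans (sym (inverseʳ g-perm a)) (trans (cong g eq) (inverseʳ g-perm b))

intertwines-inverse : {g σ τ : Fun n} (g-perm : IsPerm g) → Intertwines g σ τ →
                      Intertwines (inverse g-perm) τ σ
intertwines-inverse {g = g} {σ} {τ} g-perm gσ≗τg a = g-perm _ _ (begin
  g (inverse g-perm (τ a))     ≡⟨ inverseʳ g-perm (τ a) ⟩
  τ a                          ≡⟨ cong τ (inverseʳ g-perm a) ⟨
  τ (g (inverse g-perm a))     ≡⟨ gσ≗τg _ ⟨
  g (σ (inverse g-perm a))     ∎)
  where open ≡-Reasoning

-- The correspondence is σ ↦ g σ g⁻¹. It enters as the relation `Intertwines g`, and the transfer of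
-- P and Q is asked for every related pair because the conjugate is determined only up to `≗`.
count-conjugate : {P Q : Fun n → Set} (P? : Decidable P) (Q? : Decidable Q) {g : Fun n} → IsPerm g →
                  (∀ {σ τ} → Intertwines g σ τ → P σ → Q τ) →
                  (∀ {σ τ} → Intertwines g σ τ → Q τ → P σ) →
                  count P? (allFunsTo n n) ≡ count Q? (allFunsTo n n)
count-conjugate {n} {P} {Q} P? Q? {g} g-perm p⇒q q⇒p = begin
  count P? funs       ≡⟨ *-identityʳ _ ⟨
  count P? funs * 1   ≡⟨ double-count P? Q? (intertwines? g) funs funs 1 1 rows columns ⟩
  count Q? funs * 1   ≡⟨ *-identityʳ _ ⟩
  count Q? funs       ∎
  where
  open ≡-Reasoning
  funs = allFunsTo n n
  g⁻¹ = inverse g-perm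
  rows : ∀ σ → P σ → count (λ τ → Q? τ ×-dec intertwines? g σ τ) funs ≡ 1
  rows σ p = count-Fun _ (λ a → g (σ (g⁻¹ a)))
    (λ τ τ≗ → let gσ≗τg = λ x → sym (trans (τ≗ (g x)) (cong (g ∘ σ) (inverseˡ g-perm x))) in
              p⇒q gσ≗τg p , gσ≗τg)
    (λ τ (_ , gσ≗τg) a → trans (cong τ (sym (inverseʳ g-perm a))) (sym (gσ≗τg (g⁻¹ a))))
  columns : ∀ τ → Q τ → count (λ σ → P? σ ×-dec intertwines? g σ τ) funs ≡ 1
  columns τ q = count-Fun _ (λ x → g⁻¹ (τ (g x)))
    (λ σ σ≗ → let gσ≗τg = λ x → trans (cong g (σ≗ x)) (inverseʳ g-perm (τ (g x))) in
              q⇒p gσ≗τg q , gσ≗τg)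
    (λ σ (_ , gσ≗τg) x → trans (sym (inverseˡ g-perm (σ x))) (cong g⁻¹ (gσ≗τg x)))

numDiff-image : {σ τ : Fun m} {β γ : Fun n} (e : Fin m → Fin n) → (∀ i j → e i ≡ e j → i ≡ j) →
                Intertwines e σ β → Intertwines e τ γ → (∀ a → β a ≢ γ a → ∃ λ j → e j ≡ a) →
                numDiff β γ ≡ numDiff σ τ
numDiff-image {σ = σ} {τ} {β} {γ} e e-inj eσ≗βe eτ≗γe onto =
  count-Fin-image (λ a → ¬? (agree? β γ a)) (λ j → ¬? (agree? σ τ j)) e e-inj
    (λ j ≢ eq → ≢ (e-inj _ _ (trans (eσ≗βe j) (trans eq (sym (eτ≗γe j))))))
    (λ j ≢ eq → ≢ (trans (sym (eσ≗βe j)) (trans (cong e eq) (eτ≗γe j))))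
    onto

-- Conjugation by g preserves the cycle type; as g commutes with `succMod`, it also carries the
-- points where σ differs from `succMod` to those where τ does.
conjugate-fullCycle : ∀ {k} {g σ τ : Fun (suc m)} → IsPerm g → Intertwines g succMod succMod →
                      Intertwines g σ τ → FullCycle k σ → FullCycle k τ
conjugate-fullCycle {m} {k} {g} {σ} {τ} g-perm g-succ gσ≗τg (perm , full , diff) = τ-perm , τ-full , τ-diff
  where
  τ-perm : IsPerm τ
  τ-perm i j eq with perm-surjective g-perm i | perm-surjective g-perm j
  ... | x , refl | y , refl = cong g (perm x y (g-perm _ _ (trans (gσ≗τg x) (trans eq (sym (gσ≗τg y))))))
  τ-full : IsFullCycle τ
  τ-full a with x , refl ← perm-surjective g-perm a = trans
    (cycleLen-image perm τ-perm g g-perm x (λ l → iter-intertwines g σ τ gσ≗τg l x)) (full x)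
  τ-diff : numDiff succMod τ ≡ k
  τ-diff = trans (numDiff-image {σ = succMod} {σ} {succMod} {τ} g g-perm g-succ gσ≗τg (λ a _ → perm-surjective g-perm a)) diff

agreeing : ∀ m → ℕ → Fin (suc m) → ℕ
agreeing m k i = count (λ τ → fullCycle? k τ ×-dec agree? succMod τ i) (allFunsTo (suc m) (suc m))

-- Conjugation by the rotation `succMod` moves an agreement at i to one at i + 1.
agreeing-succMod : ∀ k (i : Fin (suc m)) → agreeing m k i ≡ agreeing m k (succMod i)
agreeing-succMod {m} k i = count-conjugate _ _ (succMod-perm m)
  (λ gσ≗τg (full , eq) → conjugate-fullCycle (succMod-perm m) (λ _ → refl) gσ≗τg full ,
                          trans (cong succMod eq) (gσ≗τg i))
  (λ gσ≗τg (full , eq) → conjugate-fullCycle (inverse-perm (succMod-perm m))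
                            (intertwines-inverse (succMod-perm m) (λ _ → refl))
                            (intertwines-inverse (succMod-perm m) gσ≗τg) full ,
                          succMod-perm m _ _ (trans eq (sym (gσ≗τg i))))

agreeing-const : ∀ k (i : Fin (suc m)) → agreeing m k i ≡ agreeing m k zero
agreeing-const {m} k = Fin.<-weakInduction (λ i → agreeing m k i ≡ agreeing m k zero) refl
  λ i ih → trans (cong (agreeing m k) (sym (succMod-inject₁ i))) (trans (sym (agreeing-succMod k (inject₁ i))) ih)

-- Inserting and contracting a point

skip1 : Fin (suc m) → Fin (suc (suc m))
-- The plain shift would give 1 here. Whatever led to the point now called 1 has to pass through the
-- new point 0 first, so it is redirected to 0.
skip1 zero = zero
skip1 (suc i) = suc (suc i)

merge01 : Fin (suc (suc m)) → Fin (suc m)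
merge01 zero = zero
merge01 (suc i) = i

skip1-injective : ∀ (i j : Fin (suc m)) → skip1 i ≡ skip1 j → i ≡ j
skip1-injective zero zero _ = refl
skip1-injective (suc i) (suc j) eq = Fin.suc-injective eq

skip1≢1 : ∀ (i : Fin (suc m)) → skip1 i ≢ suc zero
skip1≢1 (suc i) ()

merge01-skip1 : ∀ (i : Fin (suc m)) → merge01 (skip1 i) ≡ i
merge01-skip1 zero = refl
merge01-skip1 (suc i) = refl

skip1-merge01 : ∀ (i : Fin (suc (suc m))) → i ≢ suc zero → skip1 (merge01 i) ≡ i
skip1-merge01 zero _ = refl
skip1-merge01 (suc zero) i≢1 = contradiction refl i≢1
skip1-merge01 (suc (suc i)) _ = refl

-- The cycle σ, relabelled by x ↦ x + 1, with the point 0 put in just before 1.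
insert : Fun (suc m) → Fun (suc (suc m))
insert σ zero = suc zero
insert σ (suc x) = skip1 (σ x)

-- Since `succMod` arises by insertion from the smaller `succMod`, an inserted cycle differs from it
-- at `suc x` exactly when the original cycle differs at x, and never at 0.
insert-succMod : insert (succMod {suc m}) ≗ succMod
insert-succMod zero = refl
insert-succMod {m} (suc x) with view x
... | ‵fromℕ = trans (cong skip1 (succMod-fromℕ m)) (sym (succMod-fromℕ (suc m)))
... | ‵inject₁ i = trans (cong skip1 (succMod-inject₁ i)) (sym (succMod-inject₁ (suc i)))

insert? : (σ : Fun (suc m)) (τ : Fun (suc (suc m))) → Dec (τ ≗ insert σ)
insert? σ τ = Fin.all? λ x → τ x Fin.≟ insert σ x

module Insert {σ : Fun (suc m)} {τ : Fun (suc (suc m))} (τ≗ : τ ≗ insert σ) where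

  τ-perm : IsPerm σ → IsPerm τ
  τ-perm σ-perm i j eq = lemma i j (trans (sym (τ≗ i)) (trans eq (τ≗ j)))
    where
    lemma : ∀ i j → insert σ i ≡ insert σ j → i ≡ j
    lemma zero zero _ = refl
    lemma zero (suc j) eq = contradiction (sym eq) (skip1≢1 (σ j))
    lemma (suc i) zero eq = contradiction eq (skip1≢1 (σ i))
    lemma (suc i) (suc j) eq = cong suc (σ-perm i j (skip1-injective _ _ eq))

  σ-perm : IsPerm τ → IsPerm σ
  σ-perm τ-perm i j eq = Fin.suc-injective
    (τ-perm _ _ (trans (τ≗ (suc i)) (trans (cong skip1 eq) (sym (τ≗ (suc j))))))

  -- τ makes the step x → σ x of σ in one step, or in two when it has to pass through 0.
  simulate : IsPerm τ → ∀ l x → SameCycle τ (suc x) (suc (iter σ l x))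
  simulate τ-perm zero x = sameCycle-refl τ-perm (suc x)
  simulate τ-perm (suc l) x = sameCycle-trans τ-perm (simulate τ-perm l x) (step (iter σ l x))
    where
    step : ∀ y → SameCycle τ (suc y) (suc (σ y))
    step y with σ y | τ≗ (suc y)
    ... | zero | eq = iter⇒sameCycle τ-perm 2 (trans (cong τ eq) (τ≗ zero))
    ... | suc _ | eq = iter⇒sameCycle τ-perm 1 eq

  τ-transitive : IsPerm τ → Transitive σ → Transitive τ
  τ-transitive τ-perm σ-trans a b = sameCycle-trans τ-perm (sameCycle-sym τ-perm (from1 a)) (from1 b)
    where
    from1 : ∀ a → SameCycle τ (suc zero) a
    from1 zero = sameCycle-sym τ-perm (iter⇒sameCycle τ-perm 1 (τ≗ zero))
    from1 (suc x) with l , refl ← σ-trans zero x = simulate τ-perm (toℕ l) zero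

  -- Once 0 and 1 are merged, a step of τ is either stationary, from 0 to 1, or a single step of σ.
  contract : IsPerm σ → ∀ l y → SameCycle σ (merge01 y) (merge01 (iter τ l y))
  contract σ-perm zero y = sameCycle-refl σ-perm (merge01 y)
  contract σ-perm (suc l) y = sameCycle-trans σ-perm (contract σ-perm l y) (step (iter τ l y))
    where
    step : ∀ y → SameCycle σ (merge01 y) (merge01 (τ y))
    step zero rewrite τ≗ zero = sameCycle-refl σ-perm zero
    step (suc x) rewrite τ≗ (suc x) = iter⇒sameCycle σ-perm 1 (sym (merge01-skip1 (σ x)))

  σ-transitive : IsPerm σ → Transitive τ → Transitive σ
  σ-transitive σ-perm τ-trans a b with l , eq ← τ-trans (suc a) (suc b) =
    subst (SameCycle σ a) (cong merge01 eq) (contract σ-perm (toℕ l) (suc a))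

  numDiff-insert : numDiff succMod τ ≡ numDiff succMod σ
  numDiff-insert = count-Fin-image (λ a → ¬? (agree? succMod τ a)) (λ j → ¬? (agree? succMod σ j))
    suc (λ _ _ → Fin.suc-injective)
    (λ j ≢ eq → ≢ (skip1-injective _ _ (trans (insert-succMod (suc j)) (trans eq (τ≗ (suc j))))))
    (λ j ≢ eq → ≢ (trans (sym (insert-succMod (suc j))) (trans (cong skip1 eq) (sym (τ≗ (suc j))))))
    (λ { zero ≢ → contradiction (sym (τ≗ zero)) ≢ ; (suc j) _ → j , refl })

  fullCycle⁺ : ∀ {k} → FullCycle k σ → FullCycle k τ
  fullCycle⁺ (perm , full , diff) =
    τ-perm perm , transitive⇒full (τ-transitive (τ-perm perm) (full⇒transitive full)) , trans numDiff-insert diff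

  fullCycle⁻ : ∀ {k} → FullCycle k τ → FullCycle k σ
  fullCycle⁻ (perm , full , diff) =
    σ-perm perm , transitive⇒full (σ-transitive (σ-perm perm) (full⇒transitive full)) , trans (sym numDiff-insert) diff

agreeing-zero : ∀ m k → agreeing (suc m) k zero ≡ fullCycles m k
agreeing-zero m k = begin
  count P? big            ≡⟨ *-identityʳ _ ⟨
  count P? big * 1        ≡⟨ double-count P? (fullCycle? k) (λ τ σ → insert? σ τ) big small 1 1 rows columns ⟩
  fullCycles m k * 1      ≡⟨ *-identityʳ _ ⟩
  fullCycles m k          ∎
  where
  open ≡-Reasoning
  big = allFunsTo (suc (suc m)) (suc (suc m))
  small = allFunsTo (suc m) (suc m)
  P? = λ (τ : Fun (suc (suc m))) → fullCycle? k τ ×-dec agree? succMod τ zero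
  rows : ∀ τ → FullCycle k τ × succMod zero ≡ τ zero →
         count (λ σ → fullCycle? k σ ×-dec insert? σ τ) small ≡ 1
  rows τ (full , eq) = count-Fun _ (λ x → merge01 (τ (suc x)))
    (λ σ σ≗ → let τ≗ = expand σ σ≗ in Insert.fullCycle⁻ τ≗ full , τ≗)
    (λ σ (_ , τ≗) x → trans (sym (merge01-skip1 (σ x))) (cong merge01 (sym (τ≗ (suc x)))))
    where
    expand : ∀ σ → σ ≗ (λ x → merge01 (τ (suc x))) → τ ≗ insert σ
    expand σ σ≗ zero = sym eq
    -- The value 1 is already taken by τ at 0, so by injectivity τ (suc x) is not 1 and merging
    -- loses nothing.
    expand σ σ≗ (suc x) = sym (trans (cong skip1 (σ≗ x)) (skip1-merge01 (τ (suc x))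
      λ eq′ → contradiction (proj₁ full _ _ (trans eq′ eq)) λ ()))
  columns : ∀ σ → FullCycle k σ → count (λ τ → P? τ ×-dec insert? σ τ) big ≡ 1
  columns σ full = count-Fun _ (insert σ)
    (λ τ τ≗ → (Insert.fullCycle⁺ τ≗ full , sym (τ≗ zero)) , τ≗)
    (λ τ → proj₂)

-- Both sides count the pairs of a full cycle τ and a point where τ agrees with succMod.
fullCycles-recurrence : ∀ m k → fullCycles (suc m) k * (suc (suc m) ∸ k) ≡ suc (suc m) * fullCycles m k
fullCycles-recurrence m k = trans
  (double-count (fullCycle? k) (λ _ → yes tt) (agree? succMod) funs points (suc (suc m) ∸ k) (fullCycles m k)
    rows (λ i _ → trans (agreeing-const k i) (agreeing-zero m k)))
  (cong (_* fullCycles m k) (trans (count-all (λ _ → yes tt) (λ _ → tt) points) (length-allFin (suc (suc m)))))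
  where
  funs = allFunsTo (suc (suc m)) (suc (suc m))
  points = allFin (suc (suc m))
  rows : ∀ τ → FullCycle k τ → count (λ i → yes tt ×-dec agree? succMod τ i) points ≡ suc (suc m) ∸ k
  rows τ (_ , _ , refl) = begin
    count (λ i → yes tt ×-dec agree? succMod τ i) points
      ≡⟨ count-⇔ (λ i → yes tt ×-dec agree? succMod τ i) (agree? succMod τ) (λ _ → proj₂) (λ _ → tt ,_) points ⟩
    count (agree? succMod τ) points
      ≡⟨ ℕ.m+n∸n≡m _ (numDiff succMod τ) ⟨
    count (agree? succMod τ) points + numDiff succMod τ ∸ numDiff succMod τ
      ≡⟨ cong (_∸ numDiff succMod τ) (trans (count-¬ (agree? succMod τ) points) (length-allFin (suc (suc m)))) ⟩
    suc (suc m) ∸ numDiff succMod τ ∎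
    where open ≡-Reasoning

-- Comparison with binomial coefficients

binomial-factorial : ∀ d k → ((d + k) C k) * (k ! * d !) ≡ (d + k) !
binomial-factorial d k = begin
  ((d + k) C k) * (k ! * d !)
    ≡⟨ cong (λ x → ((d + k) C k) * (k ! * x !)) (ℕ.m+n∸n≡m d k) ⟨
  ((d + k) C k) * (k ! * (d + k ∸ k) !)
    ≡⟨ cong (_* (k ! * (d + k ∸ k) !)) (nCk≡n!/k![n-k]! (ℕ.m≤n+m k d)) ⟩
  ((d + k) ! / (k ! * (d + k ∸ k) !)) * (k ! * (d + k ∸ k) !)
    ≡⟨ m/n*n≡m (k![n∸k]!∣n! (ℕ.m≤n+m k d)) ⟩
  (d + k) ! ∎
  where
  open ≡-Reasoning
  instance
    _ = k !* (d + k ∸ k) !≢0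

-- After multiplication by k! d! both sides equal (d + k + 1)!. This is the recurrence that
-- `fullCycles` satisfies.
binomial-recurrence : ∀ d k → ((suc d + k) C k) * suc d ≡ (suc d + k) * ((d + k) C k)
binomial-recurrence d k = ℕ.*-cancelʳ-≡ _ _ (k ! * d !) {{k !* d !≢0}} (begin
  ((suc d + k) C k) * suc d * (k ! * d !)     ≡⟨ *-assoc ((suc d + k) C k) (suc d) (k ! * d !) ⟩
  ((suc d + k) C k) * (suc d * (k ! * d !))   ≡⟨ cong (((suc d + k) C k) *_) (x∙yz≈y∙xz (suc d) (k !) (d !)) ⟩
  ((suc d + k) C k) * (k ! * suc d !)         ≡⟨ binomial-factorial (suc d) k ⟩
  (suc d + k) * (d + k) !                     ≡⟨ cong ((suc d + k) *_) (binomial-factorial d k) ⟨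
  (suc d + k) * (((d + k) C k) * (k ! * d !)) ≡⟨ *-assoc (suc d + k) ((d + k) C k) (k ! * d !) ⟨
  (suc d + k) * ((d + k) C k) * (k ! * d !)   ∎)
  where open ≡-Reasoning

-- Here d is the number of points where the cycles agree with `succMod`. Both sides start at f k for
-- d = 0 and obey the same recurrence, whose factor `suc d` is positive and cancels.
fullCycles-binomial : ∀ d m → fullCycles (d + m) (suc m) ≡ (suc (d + m) C suc m) * f (suc m)
fullCycles-binomial zero m =
  trans (fullCycles-diagonal m) (sym (trans (cong (_* f (suc m)) (nCn≡1 (suc m))) (*-identityˡ _)))
fullCycles-binomial (suc d) m = ℕ.*-cancelʳ-≡ _ _ (suc d) (begin
  fullCycles (suc d + m) (suc m) * suc d
    ≡⟨ cong (fullCycles (suc d + m) (suc m) *_) gap ⟨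
  fullCycles (suc d + m) (suc m) * (suc (suc d + m) ∸ suc m)
    ≡⟨ fullCycles-recurrence (d + m) (suc m) ⟩
  suc (suc d + m) * fullCycles (d + m) (suc m)
    ≡⟨ cong (suc (suc d + m) *_) (fullCycles-binomial d m) ⟩
  suc (suc d + m) * ((suc (d + m) C suc m) * f (suc m))
    ≡⟨ *-assoc (suc (suc d + m)) (suc (d + m) C suc m) (f (suc m)) ⟨
  suc (suc d + m) * (suc (d + m) C suc m) * f (suc m)
    ≡⟨ cong (_* f (suc m)) binomial ⟨
  (suc (suc d + m) C suc m) * suc d * f (suc m)
    ≡⟨ xy∙z≈xz∙y (suc (suc d + m) C suc m) (suc d) (f (suc m)) ⟩
  (suc (suc d + m) C suc m) * f (suc m) * suc d ∎)
  where
  open ≡-Reasoning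
  gap : suc (suc d + m) ∸ suc m ≡ suc d
  gap = ℕ.m+n∸n≡m (suc d) m
  binomial : (suc (suc d + m) C suc m) * suc d ≡ suc (suc d + m) * (suc (d + m) C suc m)
  binomial = subst (λ x → (suc x C suc m) * suc d ≡ suc x * (x C suc m)) (+-suc d m)
    (binomial-recurrence d (suc m))

-- Permutations whose bad points lie in one given cycle

BadWithin : Fun n → Fin n → ℕ → Fun n → Set
BadWithin β c k α = IsPerm α × numBad α β ≡ k × (∀ a → Bad α β a → SameCycle β c a)

badWithin? : (β : Fun n) → ∀ c k → (α : Fun n) → Dec (BadWithin β c k α)
badWithin? β c k α = isPerm? α ×-dec (numBad α β ℕ.≟ k) ×-dec
  Fin.all? (λ a → bad? α β a →-dec sameCycle? β c a)

module OnCycle {n} {β : Fun n} (β-perm : IsPerm β) (c : Fin n) (β-chart : Chart β c) where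

  open Chart β-chart renaming
    (pred-length to q; embed to e; embed-injective to e-inj; embed-succMod to e-succ; embed-onto to e-onto; embed-into to e-into)

  -- Multiplied out by α, this says that α⁻¹βα maps the cycle to itself and is τ when read through
  -- e.
  Matches : Fun n → Fun (suc q) → Set
  Matches α τ = Intertwines (α ∘ e) τ β

  CommutesOutside : Fun n → Set
  CommutesOutside α = ∀ a → ¬ SameCycle β c a → α (β a) ≡ β (α a)

  badWithin⇒commutesOutside : ∀ {k α} → BadWithin β c k α → CommutesOutside α
  badWithin⇒commutesOutside (_ , _ , within) a c≁a =
    decidable-stable (_ Fin.≟ _) λ bad → c≁a (within a bad)

  commutesOutside⇒within : ∀ {α} → CommutesOutside α → ∀ a → Bad α β a → SameCycle β c a
  commutesOutside⇒within outside a bad =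
    decidable-stable (sameCycle? β c a) λ c≁a → bad (outside a c≁a)

  outside-step : ∀ {a} → ¬ SameCycle β c a → ¬ SameCycle β c (β a)
  outside-step {a} c≁a c~βa =
    c≁a (sameCycle-trans β-perm c~βa (sameCycle-sym β-perm (iter⇒sameCycle β-perm 1 refl)))

  outside-iter : ∀ {a} → ¬ SameCycle β c a → ∀ l → ¬ SameCycle β c (iter β l a)
  outside-iter c≁a zero = c≁a
  outside-iter c≁a (suc l) = outside-step (outside-iter c≁a l)

  iter-outside : ∀ {α} → CommutesOutside α → ∀ {a} → ¬ SameCycle β c a →
                 ∀ l → α (iter β l a) ≡ iter β l (α a)
  iter-outside outside c≁a zero = refl
  iter-outside outside c≁a (suc l) =
    trans (outside _ (outside-iter c≁a l)) (cong β (iter-outside outside c≁a l))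

  -- At e j the products αβ and βα take the values α (e (succMod j)) and α (e (τ j)); cancelling α
  -- and e leaves the comparison of `succMod` with τ. Off the cycle nothing is bad.
  numBad-matches : ∀ {α τ} → IsPerm α → CommutesOutside α → Matches α τ →
                   numBad α β ≡ numDiff succMod τ
  numBad-matches {α} {τ} α-perm outside matches =
    count-Fin-image (bad? α β) (λ j → ¬? (agree? succMod τ j)) e e-inj
      (λ j ≢ eq → ≢ (e-inj _ _ (α-perm _ _ (trans (cong α (e-succ j)) (trans eq (sym (matches j)))))))
      (λ j bad eq → bad (trans (cong α (sym (e-succ j))) (trans (cong (α ∘ e) eq) (matches j))))
      (λ a bad → e-onto a (commutesOutside⇒within outside a bad))

  -- α maps the complement of the cycle, hence the cycle itself, onto a union of cycles of β.
  matching-exists : ∀ {k α} → BadWithin β c k α → ∃ λ τ → Matches α τ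
  matching-exists {α = α} αok@(α-perm , _) = (λ x → proj₁ (step x)) , (λ x → proj₂ (step x))
    where
    step : ∀ x → ∃ λ y → α (e y) ≡ β (α (e x))
    step x with y , αy≡ ← perm-surjective α-perm (β (α (e x))) with sameCycle? β c y
    ... | yes c~y with j , refl ← e-onto y c~y = j , αy≡
    ... | no c≁y with z , refl ← perm-surjective β-perm y = contradiction (e-into x)
      λ c~ex → c≁y (sameCycle-step β-perm (subst (SameCycle β c) (sym z≡ex) c~ex))
      where
      c≁z : ¬ SameCycle β c z
      c≁z c~z = c≁y (sameCycle-step β-perm c~z)
      z≡ex : z ≡ e x
      z≡ex = α-perm _ _ (β-perm _ _ (trans (sym (badWithin⇒commutesOutside αok z c≁z)) αy≡))

  matches-perm : ∀ {α τ} → IsPerm α → Matches α τ → IsPerm τ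
  matches-perm {α} α-perm matches i j eq = e-inj _ _ (α-perm _ _ (β-perm _ _
    (trans (sym (matches i)) (trans (cong (α ∘ e) eq) (matches j)))))

  -- α preserves cycle lengths outside the cycle of c, so that by counting the points on cycles
  -- of length cycleLen β c it sends the cycle of c to points on cycles of the same length.
  matches-full : ∀ {k α τ} → BadWithin β c k α → Matches α τ → IsFullCycle τ
  matches-full {α = α} {τ} αok@(α-perm , _) matches x = begin
    cycleLen τ x         ≡⟨ cycleLen-image (matches-perm α-perm matches) β-perm (α ∘ e)
                              (λ i j eq → e-inj i j (α-perm _ _ eq)) x
                              (λ l → iter-intertwines (α ∘ e) τ β matches l x) ⟨
    cycleLen β (α (e x)) ≡⟨ count-⊆ after? before? shrink same (e x)
                              (sym (cycleLen-sameCycle β-perm (e-into x))) ⟩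
    cycleLen β c         ≡⟨ cycleLen≡ ⟩
    suc q                ∎
    where
    open ≡-Reasoning
    before? = λ a → cycleLen β a ℕ.≟ cycleLen β c
    after? = λ a → cycleLen β (α a) ℕ.≟ cycleLen β c
    same : count after? (allFin n) ≡ count before? (allFin n)
    same = sym (count-Fin-image before? after? α α-perm (λ _ → id) (λ _ → id)
                  (λ a _ → perm-surjective α-perm a))
    shrink : ∀ a → cycleLen β (α a) ≡ cycleLen β c → cycleLen β a ≡ cycleLen β c
    shrink a eq with sameCycle? β c a
    ... | yes c~a = sym (cycleLen-sameCycle β-perm c~a)
    ... | no c≁a = trans (sym (cycleLen-image β-perm β-perm α α-perm a
                            (iter-outside (badWithin⇒commutesOutside αok) c≁a))) eq

  matches⇒fullCycle : ∀ {k α τ} → BadWithin β c k α → Matches α τ → FullCycle k τ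
  matches⇒fullCycle αok@(α-perm , bad , _) matches =
    matches-perm α-perm matches , matches-full αok matches ,
    trans (sym (numBad-matches α-perm (badWithin⇒commutesOutside αok) matches)) bad

  -- With κ a chart of the full cycle τ, the permutation that moves e (κ x) to e x and fixes
  -- every point outside the cycle of c matches τ.
  module Realise {τ κ : Fun (suc q)} (κ-perm : IsPerm κ) (κ-succ : Intertwines κ succMod τ) where

    realisation : Fun n
    realisation a with sameCycle? β c a
    ... | yes c~a = e (inverse κ-perm (proj₁ (e-onto a c~a)))
    ... | no _ = a

    realisation-cycle : ∀ x → realisation (e (κ x)) ≡ e x
    realisation-cycle x with sameCycle? β c (e (κ x))
    ... | yes c~ = cong e (trans (cong (inverse κ-perm) (e-inj _ _ (proj₂ (e-onto _ c~)))) (inverseˡ κ-perm x))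
    ... | no c≁ = contradiction (e-into (κ x)) c≁

    realisation-outside : ∀ {a} → ¬ SameCycle β c a → realisation a ≡ a
    realisation-outside {a} c≁a with sameCycle? β c a
    ... | yes c~a = contradiction c~a c≁a
    ... | no _ = refl

    private
      onto : ∀ {a} → SameCycle β c a → ∃ λ x → e (κ x) ≡ a
      onto {a} c~a with j , refl ← e-onto a c~a with x , refl ← perm-surjective κ-perm j = x , refl

    realisation-perm : IsPerm realisation
    realisation-perm a b eq = cases (sameCycle? β c a) (sameCycle? β c b)
      where
      cases : Dec (SameCycle β c a) → Dec (SameCycle β c b) → a ≡ b
      cases (no c≁a) (no c≁b) = trans (sym (realisation-outside c≁a)) (trans eq (realisation-outside c≁b))
      -- The two mixed cases are impossible: the realisation sends the cycle into itself and fixes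
      -- every point outside it.
      cases (no c≁a) (yes c~b) with y , refl ← onto c~b = contradiction
        (subst (SameCycle β c) (trans (sym (realisation-cycle y)) (trans (sym eq) (realisation-outside c≁a))) (e-into y)) c≁a
      cases (yes c~a) (no c≁b) with x , refl ← onto c~a = contradiction
        (subst (SameCycle β c) (trans (sym (realisation-cycle x)) (trans eq (realisation-outside c≁b))) (e-into x)) c≁b
      cases (yes c~a) (yes c~b) with x , refl ← onto c~a | y , refl ← onto c~b =
        cong (e ∘ κ) (e-inj _ _ (trans (sym (realisation-cycle x)) (trans eq (realisation-cycle y))))

    realisation-commutesOutside : CommutesOutside realisation
    realisation-commutesOutside a c≁a =
      trans (realisation-outside (outside-step c≁a)) (cong β (sym (realisation-outside c≁a)))

    realisation-matches : Matches realisation τ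
    realisation-matches y with x , refl ← perm-surjective κ-perm y = begin
      realisation (e (τ (κ x)))         ≡⟨ cong (realisation ∘ e) (κ-succ x) ⟨
      realisation (e (κ (succMod x)))   ≡⟨ realisation-cycle (succMod x) ⟩
      e (succMod x)                     ≡⟨ e-succ x ⟩
      β (e x)                           ≡⟨ cong β (realisation-cycle x) ⟨
      β (realisation (e (κ x)))         ∎
      where open ≡-Reasoning


  matches? : ∀ α τ → Dec (Matches α τ)
  matches? α τ = intertwines? (α ∘ e) τ β

  matching-unique : ∀ {α σ τ} → IsPerm α → Matches α σ → Matches α τ → σ ≗ τ
  matching-unique α-perm matches matches′ x =
    e-inj _ _ (α-perm _ _ (trans (matches x) (sym (matches′ x))))

  -- The permutations matching τ form the coset of one of them under the centralizer.
  module Coset {k} {τ : Fun (suc q)} (τ-full : FullCycle k τ) {α₀ : Fun n} (α₀-perm : IsPerm α₀)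
               (α₀-outside : CommutesOutside α₀) (α₀-matches : Matches α₀ τ) where

    -- Both α and α₀ conjugate β to the same permutation, τ on the cycle and β off it, so α α₀⁻¹,
    -- which is γ, commutes with β.
    central : ∀ {α γ} → BadWithin β c k α → Matches α τ → α ≗ γ ∘ α₀ → IsPerm γ × Commute γ β
    central {α} {γ} αok@(α-perm , _) matches α≗ = γ-perm , γ-commutes
      where
      open ≡-Reasoning
      γ-perm : IsPerm γ
      γ-perm i j eq with x , refl ← perm-surjective α₀-perm i | y , refl ← perm-surjective α₀-perm j =
        cong α₀ (α-perm x y (trans (α≗ x) (trans eq (sym (α≗ y)))))
      lifted : ∀ x → γ (β (α₀ x)) ≡ β (α x)
      lifted x with sameCycle? β c x
      ... | no c≁x = begin
        γ (β (α₀ x))   ≡⟨ cong γ (α₀-outside x c≁x) ⟨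
        γ (α₀ (β x))   ≡⟨ α≗ (β x) ⟨
        α (β x)        ≡⟨ badWithin⇒commutesOutside αok x c≁x ⟩
        β (α x)        ∎
      ... | yes c~x with y , refl ← e-onto x c~x = begin
        γ (β (α₀ (e y)))   ≡⟨ cong γ (α₀-matches y) ⟨
        γ (α₀ (e (τ y)))   ≡⟨ α≗ (e (τ y)) ⟨
        α (e (τ y))        ≡⟨ matches y ⟩
        β (α (e y))        ∎
      γ-commutes : Commute γ β
      γ-commutes a with x , refl ← perm-surjective α₀-perm a = trans (lifted x) (cong β (α≗ x))

    translate : ∀ {α γ} → IsPerm γ × Commute γ β → α ≗ γ ∘ α₀ → BadWithin β c k α × Matches α τ
    translate {α} {γ} (γ-perm , γ-commutes) α≗ =
      (α-perm , trans (numBad-matches α-perm α-outside α-matches) (proj₂ (proj₂ τ-full)) ,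
        commutesOutside⇒within α-outside) , α-matches
      where
      open ≡-Reasoning
      -- Commuting outside the cycle and matching τ are both equations of this shape, for the pairs
      -- β a, a and e (τ x), e x; left multiplication by a central γ preserves them.
      transport : ∀ {x y} → α₀ x ≡ β (α₀ y) → α x ≡ β (α y)
      transport {x} {y} eq = begin
        α x            ≡⟨ α≗ x ⟩
        γ (α₀ x)       ≡⟨ cong γ eq ⟩
        γ (β (α₀ y))   ≡⟨ γ-commutes (α₀ y) ⟩
        β (γ (α₀ y))   ≡⟨ cong β (α≗ y) ⟨
        β (α y)        ∎
      α-perm : IsPerm α
      α-perm i j eq = α₀-perm i j (γ-perm _ _ (trans (sym (α≗ i)) (trans eq (α≗ j))))
      α-outside : CommutesOutside α
      α-outside a c≁a = transport (α₀-outside a c≁a)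
      α-matches : Matches α τ
      α-matches x = transport (α₀-matches x)

    count-coset : count (λ α → badWithin? β c k α ×-dec matches? α τ) (allFunsTo n n) ≡ centralizerSize β
    count-coset = begin
      count P? funs       ≡⟨ *-identityʳ _ ⟨
      count P? funs * 1   ≡⟨ double-count P? Q? (λ α γ → R? α γ) funs funs 1 1 rows columns ⟩
      count Q? funs * 1   ≡⟨ *-identityʳ _ ⟩
      count Q? funs       ≡⟨ count-filter (λ γ → Fin.all? λ a → γ (β a) Fin.≟ β (γ a)) isPerm? funs ⟨
      centralizerSize β   ∎
      where
      open ≡-Reasoning
      funs = allFunsTo n n
      P? = λ α → badWithin? β c k α ×-dec matches? α τ
      Q? = λ (γ : Fun n) → isPerm? γ ×-dec Fin.all? (λ a → γ (β a) Fin.≟ β (γ a))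
      R? : ∀ (α γ : Fun n) → Dec (α ≗ γ ∘ α₀)
      R? α γ = Fin.all? λ a → α a Fin.≟ γ (α₀ a)
      α₀⁻¹ = inverse α₀-perm
      rows : ∀ α → BadWithin β c k α × Matches α τ → count (λ γ → Q? γ ×-dec R? α γ) funs ≡ 1
      rows α (αok , matches) = count-Fun _ (α ∘ α₀⁻¹)
        (λ γ γ≗ → let α≗ = λ a → sym (trans (γ≗ (α₀ a)) (cong α (inverseˡ α₀-perm a))) in
                  central αok matches α≗ , α≗)
        (λ γ (_ , α≗) a → trans (cong γ (sym (inverseʳ α₀-perm a))) (sym (α≗ (α₀⁻¹ a))))
      columns : ∀ γ → IsPerm γ × Commute γ β → count (λ α → P? α ×-dec R? α γ) funs ≡ 1
      columns γ γok = count-Fun _ (γ ∘ α₀) (λ α α≗ → translate γok α≗ , α≗) (λ α → proj₂)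

  count-matches : ∀ {k τ} → FullCycle k τ →
                  count (λ α → badWithin? β c k α ×-dec matches? α τ) (allFunsTo n n) ≡ centralizerSize β
  count-matches {τ = τ} τ-full@(τ-perm , full , _) with chart τ-perm zero
  ... | record { cycleLen≡ = len ; embed = κ ; embed-injective = κ-perm ; embed-succMod = κ-succ }
    -- As τ is a full cycle, the chart at 0 has all of `Fin (suc q)` as its domain, so its embedding
    -- κ is a permutation conjugating `succMod` to τ.
    with refl ← suc-injective (trans (sym len) (full zero)) =
    Coset.count-coset τ-full realisation-perm realisation-commutesOutside realisation-matches
    where open Realise {τ} {κ} κ-perm κ-succ

  count-badWithin : ∀ k → count (badWithin? β c k) (allFunsTo n n) ≡ fullCycles q k * centralizerSize β
  count-badWithin k = trans (sym (*-identityʳ _))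
    (double-count (badWithin? β c k) (fullCycle? k) matches? (allFunsTo n n) (allFunsTo (suc q) (suc q))
      1 (centralizerSize β) rows (λ τ → count-matches))
    where
    rows : ∀ α → BadWithin β c k α →
           count (λ τ → fullCycle? k τ ×-dec matches? α τ) (allFunsTo (suc q) (suc q)) ≡ 1
    rows α αok@(α-perm , _) with τ₀ , matches₀ ← matching-exists αok = count-Fun _ τ₀
      (λ τ τ≗ → let matches = λ x → trans (cong (α ∘ e) (τ≗ x)) (matches₀ x) in
                matches⇒fullCycle αok matches , matches)
      (λ τ (_ , matches) → matching-unique α-perm matches matches₀)

-- Summation over the cycles

-- The sum runs over all cycles, including those shorter than k. For these both sides vanish, as a
-- map cannot differ in more points than it has.
fullCycles-count : ∀ q m → fullCycles q (suc m) ≡ (suc q C suc m) * f (suc m)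
fullCycles-count q m with suc m ℕ.≤? suc q
... | yes (s≤s m≤q) = subst (λ x → fullCycles x (suc m) ≡ (suc x C suc m) * f (suc m))
                        (ℕ.m∸n+n≡m m≤q) (fullCycles-binomial (q ∸ m) m)
... | no m≰q = trans
  (count-none (fullCycle? (suc m)) (λ τ (_ , _ , diff) → m≰q (subst (_≤ suc q) diff
      (≤-trans (List.length-filter (λ a → ¬? (agree? succMod τ a)) (allFin (suc q))) (≤-reflexive (length-allFin (suc q))))))
    (allFunsTo (suc q) (suc q)))
  (sym (cong (_* f (suc m)) (k>n⇒nCk≡0 (ℕ.≰⇒> m≰q))))

count-badWithin-binomial : {β : Fun n} → IsPerm β → ∀ c m →
  count (badWithin? β c (suc m)) (allFunsTo n n) ≡
  (cycleLen β c C suc m) * f (suc m) * centralizerSize β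
count-badWithin-binomial {β = β} β-perm c m = go (chart β-perm c)
  where
  go : Chart β c → _
  go β-chart = trans (OnCycle.count-badWithin β-perm c β-chart (suc m))
    (cong (_* centralizerSize β) (trans (fullCycles-count pred-length m)
      (cong (λ x → (x C suc m) * f (suc m)) (sym cycleLen≡))))
    where open Chart β-chart

-- Since k is positive, some point is bad, and its cycle is the only one that can contain all bad
-- points; the least point stands for the cycle so that each α is counted once.
cLam-partition : {β : Fun n} → IsPerm β → ∀ m → cLam (suc m) β ≡
  ∑ (allFin n) (λ c → count (λ α → isCycleRep? β c ×-dec badWithin? β c (suc m) α) (allFunsTo n n))
cLam-partition {n} {β} β-perm m = trans
  (count-filter (kCommOneCycle? (suc m) β) isPerm? (allFunsTo n n))
  (count-partition (λ α → isPerm? α ×-dec kCommOneCycle? (suc m) β α)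
    (λ α c → isCycleRep? β c ×-dec badWithin? β c (suc m) α) (allFunsTo n n) (allFin n)
    unique (λ { α c (_ , α-perm , bad , within) → α-perm , bad , c , within }))
  where
  bad-exists : ∀ {α} → numBad α β ≡ suc m → ∃ (Bad α β)
  bad-exists {α} bad with Fin.any? (bad? α β)
  ... | yes some = some
  ... | no none = contradiction (trans (sym bad) (count-none (bad? α β) (λ a b → none (a , b)) (allFin n))) λ ()
  unique : ∀ α → IsPerm α × KCommOneCycle (suc m) β α →
           count (λ c → isCycleRep? β c ×-dec badWithin? β c (suc m) α) (allFin n) ≡ 1
  unique α (α-perm , bad , c₀ , within)
    with a , a-bad ← bad-exists bad | c , c-rep , c~c₀ ← cycleRep β-perm c₀ =
    count-Fin _ c (c-rep , α-perm , bad , within-c)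
      (λ d (d-rep , _ , _ , within-d) → cycleRep-unique β-perm d-rep (within-d a a-bad) c-rep (within-c a a-bad))
    where
    within-c : ∀ b → Bad α β b → SameCycle β c b
    within-c b b-bad = sameCycle-trans β-perm c~c₀ (within b b-bad)

sumFromTo≡∑ : ∀ k n g → sumFromTo k n g ≡ ∑ (upTo (suc n ∸ k)) (λ i → g (k + i))
sumFromTo≡∑ k n g = cong sum (sym (List.map-upTo (λ i → g (k + i)) (suc n ∸ k)))

sumFromTo-cong : ∀ k n {g h} → g ≗ h → sumFromTo k n g ≡ sumFromTo k n h
sumFromTo-cong k n {g} {h} g≗h = trans (sumFromTo≡∑ k n g)
  (trans (∑-cong (upTo (suc n ∸ k)) (λ i → g≗h (k + i))) (sym (sumFromTo≡∑ k n h)))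

-- Cycles are grouped by length. Lengths never exceed n, and those below k, missing from the range
-- of summation, contribute nothing because h vanishes there.
sum-by-length : (β : Fun n) → ∀ k (h : ℕ → ℕ) → (∀ ℓ → ℓ < k → h ℓ ≡ 0) →
  sumFromTo k n (λ ℓ → cycleCount β ℓ * h ℓ) ≡ ∑ (allFin n) (λ c → 𝟙 (isCycleRep? β c) * h (cycleLen β c))
sum-by-length {n} β k h h-small = begin
  sumFromTo k n (λ ℓ → cycleCount β ℓ * h ℓ)
    ≡⟨ sumFromTo≡∑ k n (λ ℓ → cycleCount β ℓ * h ℓ) ⟩
  ∑ (upTo N) (λ i → cycleCount β (k + i) * h (k + i))
    ≡⟨ ∑-cong (upTo N) spread ⟩
  ∑ (upTo N) (λ i → ∑ (allFin n) (λ c → 𝟙 (ofLength? c i) * h (cycleLen β c)))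
    ≡⟨ ∑-swap (upTo N) (allFin n) _ ⟩
  ∑ (allFin n) (λ c → ∑ (upTo N) (λ i → 𝟙 (ofLength? c i) * h (cycleLen β c)))
    ≡⟨ ∑-cong (allFin n) gather ⟩
  ∑ (allFin n) (λ c → 𝟙 (isCycleRep? β c) * h (cycleLen β c)) ∎
  where
  open ≡-Reasoning
  N = suc n ∸ k
  ofLength? = λ c i → isCycleRep? β c ×-dec (cycleLen β c ℕ.≟ k + i)
  spread : ∀ i → cycleCount β (k + i) * h (k + i) ≡ ∑ (allFin n) (λ c → 𝟙 (ofLength? c i) * h (cycleLen β c))
  spread i = begin
    cycleCount β (k + i) * h (k + i)
      ≡⟨ cong (_* h (k + i)) (count≡∑ (λ c → ofLength? c i) (allFin n)) ⟩
    ∑ (allFin n) (λ c → 𝟙 (ofLength? c i)) * h (k + i)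
      ≡⟨ ∑-*ʳ (h (k + i)) (allFin n) _ ⟨
    ∑ (allFin n) (λ c → 𝟙 (ofLength? c i) * h (k + i))
      ≡⟨ ∑-cong (allFin n) (λ c → relabel c (ofLength? c i)) ⟩
    ∑ (allFin n) (λ c → 𝟙 (ofLength? c i) * h (cycleLen β c)) ∎
    where
    relabel : ∀ c (d : Dec (IsCycleRep β c × cycleLen β c ≡ k + i)) → 𝟙 d * h (k + i) ≡ 𝟙 d * h (cycleLen β c)
    relabel c (yes (_ , eq)) = cong (λ ℓ → 1 * h ℓ) (sym eq)
    relabel c (no _) = refl
  -- A length ℓ ≥ k is met once, at i = ℓ - k; a length below k is never met, but then h is 0.
  lengths : ∀ c → count (λ i → cycleLen β c ℕ.≟ k + i) (upTo N) * h (cycleLen β c) ≡ h (cycleLen β c)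
  lengths c with k ℕ.≤? cycleLen β c
  ... | no k≰ℓ = trans (cong (count _ (upTo N) *_) h≡0) (trans (*-zeroʳ (count _ (upTo N))) (sym h≡0))
    where h≡0 = h-small _ (ℕ.≰⇒> k≰ℓ)
  ... | yes k≤ℓ = trans (cong (_* h (cycleLen β c)) once) (*-identityˡ _)
    where
    once : count (λ i → cycleLen β c ℕ.≟ k + i) (upTo N) ≡ 1
    once = count-∈ _ (upTo⁺ N) (∈-upTo⁺ (ℕ.∸-monoˡ-< (s≤s (cycleLen≤n β c)) k≤ℓ))
      (sym (ℕ.m+[n∸m]≡n k≤ℓ))
      (λ i eq → sym (trans (cong (_∸ k) eq) (ℕ.m+n∸m≡n k i)))
  gather : ∀ c → ∑ (upTo N) (λ i → 𝟙 (ofLength? c i) * h (cycleLen β c)) ≡ 𝟙 (isCycleRep? β c) * h (cycleLen β c)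
  gather c = begin
    ∑ (upTo N) (λ i → 𝟙 (ofLength? c i) * h (cycleLen β c))
      ≡⟨ ∑-*ʳ (h (cycleLen β c)) (upTo N) _ ⟩
    ∑ (upTo N) (λ i → 𝟙 (ofLength? c i)) * h (cycleLen β c)
      ≡⟨ cong (_* h (cycleLen β c)) (count≡∑ (ofLength? c) (upTo N)) ⟨
    count (ofLength? c) (upTo N) * h (cycleLen β c)
      ≡⟨ cong (_* h (cycleLen β c)) (count-× (isCycleRep? β c) (λ i → cycleLen β c ℕ.≟ k + i) (upTo N)) ⟩
    𝟙 (isCycleRep? β c) * count (λ i → cycleLen β c ℕ.≟ k + i) (upTo N) * h (cycleLen β c)
      ≡⟨ *-assoc (𝟙 (isCycleRep? β c)) _ _ ⟩
    𝟙 (isCycleRep? β c) * (count (λ i → cycleLen β c ℕ.≟ k + i) (upTo N) * h (cycleLen β c))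
      ≡⟨ cong (𝟙 (isCycleRep? β c) *_) (lengths c) ⟩
    𝟙 (isCycleRep? β c) * h (cycleLen β c) ∎

theorem3 : (n : ℕ) (β : Fin n → Fin n) → IsPerm β → (k : ℕ) → 3 ≤ k → k ≤ n →
    cLam k β ≡ centralizerSize β * sumFromTo k n (λ ℓ → cycleCount β ℓ * (ℓ C k) * f k)
theorem3 n β β-perm k@(suc m) _ _ = begin
  cLam k β
    ≡⟨ cLam-partition β-perm m ⟩
  ∑ (allFin n) (λ c → count (λ α → isCycleRep? β c ×-dec badWithin? β c k α) (allFunsTo n n))
    ≡⟨ ∑-cong (allFin n) fibre ⟩
  ∑ (allFin n) (λ c → 𝟙 (isCycleRep? β c) * h (cycleLen β c) * centralizerSize β)
    ≡⟨ ∑-*ʳ (centralizerSize β) (allFin n) _ ⟩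
  ∑ (allFin n) (λ c → 𝟙 (isCycleRep? β c) * h (cycleLen β c)) * centralizerSize β
    ≡⟨ *-comm _ (centralizerSize β) ⟩
  centralizerSize β * ∑ (allFin n) (λ c → 𝟙 (isCycleRep? β c) * h (cycleLen β c))
    ≡⟨ cong (centralizerSize β *_) (sum-by-length β k h (λ ℓ ℓ<k → cong (_* f k) (k>n⇒nCk≡0 ℓ<k))) ⟨
  centralizerSize β * sumFromTo k n (λ ℓ → cycleCount β ℓ * h ℓ)
    ≡⟨ cong (centralizerSize β *_) (sumFromTo-cong k n (λ ℓ → *-assoc (cycleCount β ℓ) (ℓ C k) (f k))) ⟨
  centralizerSize β * sumFromTo k n (λ ℓ → cycleCount β ℓ * (ℓ C k) * f k) ∎
  where
  open ≡-Reasoning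
  h : ℕ → ℕ
  h ℓ = (ℓ C k) * f k
  fibre : ∀ c → count (λ α → isCycleRep? β c ×-dec badWithin? β c k α) (allFunsTo n n) ≡
                𝟙 (isCycleRep? β c) * h (cycleLen β c) * centralizerSize β
  fibre c = trans (count-× (isCycleRep? β c) (badWithin? β c k) (allFunsTo n n))
    (trans (cong (𝟙 (isCycleRep? β c) *_) (count-badWithin-binomial β-perm c m))
           (sym (*-assoc (𝟙 (isCycleRep? β c)) (h (cycleLen β c)) (centralizerSize β))))
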